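{- Let $t, s$ be non-negative integers. Let $k \ge s+1$, $n \ge 2k+t$ and $m > k+t+s$ be integers. Let $$\mathcal{F} \subseteq \left\{A\in \binom{[n]}{k+t}: |A\cap[m]|\ge t+s+1\right\} \quad\text{and}\quad \mathcal{G} \subseteq \left\{B\in \binom{[n]}{k}: |B\cap[m]|\ge s+1\right\}$$ be cross-intersecting families. Suppose that $\mathcal{F}$ is $t$-intersecting. Then $$|\mathcal{F}|+|\mathcal{G}| \le \binom{n}{k}-\sum_{i=0}^{s}\binom{m}{i}\binom{n-m}{k-i}.$$
   Context: $[n]=\{1,2,\ldots,n\}$, and for a set $X$, $\binom{X}{k}$ denotes the family of all $k$-element subsets of $X$. Two families $\mathcal{F},\mathcal{G}\subseteq 2^{[n]}$ are cross-intersecting if $|F\cap G|\ge 1$ for all $F\in\mathcal{F}$ and $G\in\mathcal{G}$. A family $\mathcal{F}\subseteq 2^{[n]}$ is $t$-intersecting if $|F\cap F'|\ge t$ for all $F,F'\in\mathcal{F}$. The integer $m$ is allowed to be larger than $n$. Convention: for integers $a$ and $b\ge 0$, $\binom{a}{b}=0$ whenever $a<b$, including when $a$ is negative; thus for $m\ge n$ the right-hand side equals $\binom{n}{k}$. -}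

module Defs where

open import Data.Fin.Base using (toℕ)
open import Data.Fin.Subset using (Subset; _∩_; ∣_∣)
open import Data.Integer.Base using (ℤ; +_; -[1+_])
open import Data.List.Base using (List; length)
open import Data.List.Membership.Propositional using () renaming (_∈_ to _∈ˡ_)
open import Data.List.Relation.Unary.Unique.Propositional using (Unique)
open import Data.Nat.Base using (ℕ; _≤_; _<ᵇ_)
open import Data.Nat.Combinatorics using (_C_)
open import Data.Vec.Base using (tabulate)

-- A (necessarily finite) family of subsets of [n], listed without repetition.
record Family (n : ℕ) : Set where
  field
    members  : List (Subset n)
    distinct : Unique members

open Family public

infix 4 _∈_
_∈_ : ∀ {n} → Subset n → Family n → Set
A ∈ 𝓕 = A ∈ˡ members 𝓕

size : ∀ {n} → Family n → ℕ
size 𝓕 = length (members 𝓕)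

CrossIntersecting : ∀ {n} → Family n → Family n → Set
CrossIntersecting 𝓕 𝓖 = ∀ A B → A ∈ 𝓕 → B ∈ 𝓖 → 1 ≤ ∣ A ∩ B ∣

Intersecting : ∀ {n} → ℕ → Family n → Set
Intersecting t 𝓕 = ∀ A B → A ∈ 𝓕 → B ∈ 𝓕 → t ≤ ∣ A ∩ B ∣

-- [m] ∩ [n] as a subset of [n].  The index i : Fin n stands for the element
-- toℕ i + 1 of [n], which lies in [m] exactly when toℕ i < m; for m ≥ n this is
-- all of [n].
initial : ∀ {n} → ℕ → Subset n
initial m = tabulate (λ i → toℕ i <ᵇ m)

-- Binomial coefficient with integer upper argument, under the convention that it
-- is 0 whenever the upper argument is less than the lower one, hence for every
-- negative upper argument (not the polynomial extension).
binom : ℤ → ℕ → ℕ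
binom (+ a)    b = a C b
binom -[1+ _ ] b = 0

-- Compressing 𝓕 and 𝓖 simultaneously preserves every hypothesis and both cardinalities, so they
-- may be assumed closed under moving an element to a smaller empty position. For such
-- families, intersections of size ≥ t force some j with ∣ A ∩ [j] ∣ + ∣ B ∩ [j] ∣ ≥ j + t.
-- With B = A this says that the lattice path of every A ∈ 𝓕 (members are up-steps) gets
-- to height t, and since n ≥ 2k + t it ends at height ≤ t. Complementing A on [j], where
-- j is the last visit to height t, is injective and gives a k-set A′ that meets [m] in
-- more than s elements: in ∣ A ∩ [m] ∣ - t of them if j ≤ m, and otherwise in
-- m - ∣ A ∩ [m] ∣ ≥ m - (k + t) of them. Moreover ∣ A ∩ [i] ∣ + ∣ A′ ∩ [i] ∣ ≤ i for
-- all i, so A′ ∉ 𝓖 by cross-intersection. Hence ∣ 𝓕 ∣ + ∣ 𝓖 ∣ is at most the number of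
-- k-sets that meet [m] in more than s elements.

module Submission where

open import Defs
open import Data.Bool using (Bool; true; false; T; not; _∧_; _∨_)
import Data.Bool.Properties as Bool
open import Data.Empty using (⊥-elim)
open import Data.Fin using (Fin; zero; suc)
import Data.Fin.Properties as Fin
open import Data.Fin.Subset using (Subset; _∩_; ∣_∣)
open import Data.Fin.Subset.Properties using (p∩q⊆p; p⊆q⇒∣p∣≤∣q∣)
open import Data.Integer using (+_; _-_; +≤+) renaming (_≤_ to _≤ᶻ_)
import Data.Integer as ℤ
import Data.Integer.Properties as ℤ
open import Data.List using (List; []; _∷_; _∷ʳ_; map; upTo; length)
open import Data.List.Membership.DecPropositional using () renaming (_∈?_ to mem?)
open import Data.List.Properties using (map-++; applyUpTo-∷ʳ)
import Data.List.Relation.Unary.All as All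
open import Data.List.Relation.Unary.AllPairs using ([]; _∷_)
open import Data.List.Relation.Unary.Any using (here; there)
open import Data.List.Relation.Unary.Unique.Propositional using (Unique)
open import Data.Nat using (ℕ; zero; suc; _+_; _*_; _∸_; _≤_; _<_; z≤n; s≤s; _≤?_; _<?_; _≟_)
open import Data.Nat.Combinatorics using (_C_; nCk+nC[k+1]≡[n+1]C[k+1])
open import Data.Nat.Induction using (<-wellFounded)
open import Data.Nat.ListAction using (sum)
open import Data.Nat.ListAction.Properties using (sum-++)
open import Data.Nat.Properties
open import Algebra.Properties.CommutativeSemigroup +-commutativeSemigroup using (interchange)
open import Data.Product using (_×_; _,_; proj₁; proj₂; ∃; Σ)
open import Data.Sum using (_⊎_; inj₁; inj₂)
open import Data.Unit using (tt)
open import Data.Vec using ([]; _∷_)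
import Data.Vec.Properties as Vec
open import Function using (_∘_; Equivalence)
open import Induction.WellFounded using (Acc; acc)
open import Relation.Binary.Construct.Closure.ReflexiveTransitive using (Star; ε; _◅_; _◅◅_; gmap)
open import Relation.Binary.PropositionalEquality
  using (_≡_; refl; sym; trans; cong; cong₂; subst; subst₂)
open import Relation.Nullary using (¬_; Dec; yes; no; contradiction)
open import Relation.Nullary.Decidable using (⌊_⌋; toWitness; fromWitness; _×-dec_; T?)

private variable
  n m d p q : ℕ

_≟ˢ_ : (A B : Subset n) → Dec (A ≡ B)
_≟ˢ_ = Vec.≡-dec Bool._≟_

-- Sums over all subsets

∑ : (Subset n → ℕ) → ℕ
∑ {zero}  f = f []
∑ {suc n} f = ∑ (f ∘ (false ∷_)) + ∑ (f ∘ (true ∷_))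

∑-mono : {f g : Subset n → ℕ} → (∀ A → f A ≤ g A) → ∑ f ≤ ∑ g
∑-mono {zero}  f≤g = f≤g []
∑-mono {suc n} f≤g = +-mono-≤ (∑-mono (f≤g ∘ (false ∷_))) (∑-mono (f≤g ∘ (true ∷_)))

∑-+ : (f g : Subset n → ℕ) → ∑ (λ A → f A + g A) ≡ ∑ f + ∑ g
∑-+ {zero}  f g = refl
∑-+ {suc n} f g = trans
  (cong₂ _+_ (∑-+ (f ∘ (false ∷_)) (g ∘ (false ∷_))) (∑-+ (f ∘ (true ∷_)) (g ∘ (true ∷_))))
  (interchange (∑ (f ∘ (false ∷_))) _ _ _)

∑-zero : ∑ {n} (λ _ → 0) ≡ 0
∑-zero {zero}  = refl
∑-zero {suc n} = cong₂ _+_ (∑-zero {n}) (∑-zero {n})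

∑-swap : (f : Subset m → Subset n → ℕ) → ∑ (λ A → ∑ (f A)) ≡ ∑ (λ B → ∑ (λ A → f A B))
∑-swap {zero}  f = refl
∑-swap {suc m} f = trans
  (cong₂ _+_ (∑-swap (f ∘ (false ∷_))) (∑-swap (f ∘ (true ∷_))))
  (sym (∑-+ (λ B → ∑ (λ A → f (false ∷ A) B)) (λ B → ∑ (λ A → f (true ∷ A) B))))

term≤∑ : (f : Subset n → ℕ) (A : Subset n) → f A ≤ ∑ f
term≤∑ f []          = ≤-refl
term≤∑ f (false ∷ A) = ≤-trans (term≤∑ (f ∘ (false ∷_)) A) (m≤m+n _ _)
term≤∑ f (true  ∷ A) = ≤-trans (term≤∑ (f ∘ (true ∷_)) A) (m≤n+m _ _)

+-squeeze : ∀ {a a′ b b′} → a ≤ a′ → b ≤ b′ → a′ + b′ ≤ a + b → (a′ ≤ a) × (b′ ≤ b)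
+-squeeze {a} {a′} {b} {b′} a≤a′ b≤b′ le =
  +-cancelʳ-≤ b _ _ (≤-trans (+-monoʳ-≤ a′ b≤b′) le) ,
  +-cancelˡ-≤ a _ _ (≤-trans (+-monoˡ-≤ b′ a≤a′) le)

-- Once the totals compare the other way, there is no room for a strict inequality at any single
-- set. This yields pointwise information from a compression that leaves a total weight unchanged.
∑-squeeze : {f g : Subset n → ℕ} → (∀ A → f A ≤ g A) → ∑ g ≤ ∑ f → ∀ A → g A ≤ f A
∑-squeeze f≤g ≥ []      = ≥
∑-squeeze f≤g ≥ (b ∷ A)
  with +-squeeze (∑-mono (f≤g ∘ (false ∷_))) (∑-mono (f≤g ∘ (true ∷_))) ≥
∑-squeeze f≤g ≥ (false ∷ A) | ≥₀ , _ = ∑-squeeze (f≤g ∘ (false ∷_)) ≥₀ A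
∑-squeeze f≤g ≥ (true  ∷ A) | _ , ≥₁ = ∑-squeeze (f≤g ∘ (true ∷_)) ≥₁ A

-- Families as indicator functions

𝟙 : Bool → ℕ
𝟙 false = 0
𝟙 true  = 1

𝟙≤1 : ∀ b → 𝟙 b ≤ 1
𝟙≤1 false = z≤n
𝟙≤1 true  = ≤-refl

𝟙≤ : ∀ {a k} → (T a → 1 ≤ k) → 𝟙 a ≤ k
𝟙≤ {false} _   = z≤n
𝟙≤ {true}  1≤k = 1≤k tt

𝟙-mono : ∀ {a b} → (T a → T b) → 𝟙 a ≤ 𝟙 b
𝟙-mono {false}         imp = z≤n
𝟙-mono {true}  {true}  imp = ≤-refl
𝟙-mono {true}  {false} imp = ⊥-elim (imp tt)

𝟙-disjoint : ∀ {a b c} → (T a → ¬ T b) → (T a → T c) → (T b → T c) → 𝟙 a + 𝟙 b ≤ 𝟙 c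
𝟙-disjoint {false}         a⊥b a⇒c b⇒c = 𝟙-mono b⇒c
𝟙-disjoint {true}  {true}  a⊥b a⇒c b⇒c = ⊥-elim (a⊥b tt tt)
𝟙-disjoint {true}  {false} a⊥b a⇒c b⇒c = ≤-trans (≤-reflexive (+-identityʳ 1)) (𝟙-mono a⇒c)

Indicator : ℕ → Set
Indicator n = Subset n → Bool

infix 4 _∈ᵢ_
_∈ᵢ_ : Subset n → Indicator n → Set
A ∈ᵢ φ = T (φ A)

card : Indicator n → ℕ
card φ = ∑ (𝟙 ∘ φ)

card-empty⊎inhabited : (φ : Indicator n) → (card φ ≡ 0) ⊎ ∃ (_∈ᵢ φ)
card-empty⊎inhabited {zero} φ with φ [] in eq
... | false = inj₁ refl
... | true  = inj₂ ([] , subst T (sym eq) tt)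
card-empty⊎inhabited {suc n} φ
  with card-empty⊎inhabited (φ ∘ (false ∷_)) | card-empty⊎inhabited (φ ∘ (true ∷_))
... | inj₂ (A , A∈) | _             = inj₂ (false ∷ A , A∈)
... | inj₁ _        | inj₂ (A , A∈) = inj₂ (true ∷ A , A∈)
... | inj₁ e₀       | inj₁ e₁       = inj₁ (cong₂ _+_ e₀ e₁)

card-subsingleton : (φ : Indicator n) → (∀ {A B} → A ∈ᵢ φ → B ∈ᵢ φ → A ≡ B) → card φ ≤ 1
card-subsingleton {zero}  φ uniq = 𝟙≤1 (φ [])
card-subsingleton {suc n} φ uniq
  with card-empty⊎inhabited (φ ∘ (false ∷_)) | card-empty⊎inhabited (φ ∘ (true ∷_))
... | inj₂ (A , A∈) | inj₂ (B , B∈) with () ← uniq A∈ B∈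
... | inj₁ e | _ rewrite e =
  card-subsingleton (φ ∘ (true ∷_)) (λ x y → Vec.∷-injectiveʳ (uniq x y))
... | _ | inj₁ e rewrite e =
  ≤-trans (≤-reflexive (+-identityʳ _))
    (card-subsingleton (φ ∘ (false ∷_)) (λ x y → Vec.∷-injectiveʳ (uniq x y)))

card-mono : (φ ψ : Indicator n) → (∀ {A} → A ∈ᵢ φ → A ∈ᵢ ψ) → card φ ≤ card ψ
card-mono φ ψ φ⊆ψ = ∑-mono (λ A → 𝟙-mono (φ⊆ψ {A}))

card-disjoint : (φ ψ χ : Indicator n) → (∀ {A} → A ∈ᵢ φ → ¬ (A ∈ᵢ ψ)) →
  (∀ {A} → A ∈ᵢ φ → A ∈ᵢ χ) → (∀ {A} → A ∈ᵢ ψ → A ∈ᵢ χ) → card φ + card ψ ≤ card χ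
card-disjoint φ ψ χ φ⊥ψ φ⊆χ ψ⊆χ = ≤-trans
  (≤-reflexive (sym (∑-+ (𝟙 ∘ φ) (𝟙 ∘ ψ))))
  (∑-mono (λ A → 𝟙-disjoint (φ⊥ψ {A}) φ⊆χ ψ⊆χ))

-- Double counting on the graph of `f`: each member of `φ` has a point in its row, while by
-- injectivity a column has at most one point, and none outside `ψ`. The map takes a membership
-- proof because reflection is available for members only.
card-injection : (φ ψ : Indicator n) (f : ∀ {A} → A ∈ᵢ φ → Subset n) →
  (∀ {A} (a : A ∈ᵢ φ) → f a ∈ᵢ ψ) →
  (∀ {A B} (a : A ∈ᵢ φ) (b : B ∈ᵢ φ) → f a ≡ f b → A ≡ B) →
  card φ ≤ card ψ
card-injection {n} φ ψ f f∈ψ f-inj = begin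
  card φ                                  ≤⟨ ∑-mono row ⟩
  ∑ (λ A → ∑ (λ B → 𝟙 ⌊ graph? A B ⌋))  ≡⟨ ∑-swap (λ A B → 𝟙 ⌊ graph? A B ⌋) ⟩
  ∑ (λ B → ∑ (λ A → 𝟙 ⌊ graph? A B ⌋))  ≤⟨ ∑-mono column ⟩
  card ψ                                  ∎
  where
  open ≤-Reasoning

  Graph : Subset n → Subset n → Set
  Graph A B = Σ (A ∈ᵢ φ) λ a → f a ≡ B

  graph? : ∀ A B → Dec (Graph A B)
  graph? A B with T? (φ A)
  ... | no ¬a = no (¬a ∘ proj₁)
  ... | yes a with f a ≟ˢ B
  ...   | yes eq = yes (a , eq)
  -- A priori `f` may depend on the proof of membership; such proofs are unique.
  ...   | no neq = no λ (a′ , eq) → neq (trans (cong f (Bool.T-irrelevant a a′)) eq)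

  row : ∀ A → 𝟙 (φ A) ≤ ∑ (λ B → 𝟙 ⌊ graph? A B ⌋)
  row A = 𝟙≤ λ a → ≤-trans
    (𝟙-mono {a = true} (λ _ → fromWitness (a , refl)))
    (term≤∑ (λ B → 𝟙 ⌊ graph? A B ⌋) (f a))

  column : ∀ B → ∑ (λ A → 𝟙 ⌊ graph? A B ⌋) ≤ 𝟙 (ψ B)
  column B with card-empty⊎inhabited (λ A → ⌊ graph? A B ⌋)
  ... | inj₁ e = ≤-trans (≤-reflexive e) z≤n
  ... | inj₂ (A , g) with toWitness g
  ...   | a , refl = ≤-trans
    (card-subsingleton _ λ x y →
      f-inj (proj₁ (toWitness x)) (proj₁ (toWitness y))
        (trans (proj₂ (toWitness x)) (sym (proj₂ (toWitness y)))))
    (𝟙-mono {a = true} (λ _ → f∈ψ a))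

T-∧⁺ : ∀ {a b} → T a → T b → T (a ∧ b)
T-∧⁺ {true} {true} _ _ = tt

T-∧⁻ : ∀ {a b} → T (a ∧ b) → T a × T b
T-∧⁻ = Equivalence.to Bool.T-∧

T-∨⁻ : ∀ {a b} → T (a ∨ b) → T a ⊎ T b
T-∨⁻ = Equivalence.to Bool.T-∨

-- Compression

-- Step i A B: the element in position i + 1 of A moves to the empty position i.
data Step : Fin n → Subset n → Subset n → Set where
  here  : {A : Subset n} → Step zero (false ∷ true ∷ A) (true ∷ false ∷ A)
  there : ∀ {i b} {A B : Subset n} → Step i A B → Step (suc i) (b ∷ A) (b ∷ B)

infix 4 _⟶_ _⟶*_
_⟶_ _⟶*_ : Subset n → Subset n → Set
A ⟶ B = ∃ λ i → Step i A B
_⟶*_ = Star _⟶_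

there⟶ : ∀ {b} {A B : Subset n} → A ⟶ B → b ∷ A ⟶ b ∷ B
there⟶ (i , s) = suc i , there s

-- The (i , i + 1)-compression of extremal set theory: it replaces A by B whenever
-- Step i A B and B is not yet a member.
compress : Fin n → Indicator n → Indicator n
compress {suc zero}    zero    φ A                  = φ A
compress {suc (suc n)} zero    φ (false ∷ false ∷ A) = φ (false ∷ false ∷ A)
compress {suc (suc n)} zero    φ (false ∷ true  ∷ A) = φ (false ∷ true ∷ A) ∧ φ (true ∷ false ∷ A)
compress {suc (suc n)} zero    φ (true  ∷ false ∷ A) = φ (false ∷ true ∷ A) ∨ φ (true ∷ false ∷ A)
compress {suc (suc n)} zero    φ (true  ∷ true  ∷ A) = φ (true ∷ true ∷ A)
compress {suc (suc n)} (suc i) φ (b ∷ A)             = compress i (φ ∘ (b ∷_)) A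

-- Weight of a family under compression

weigh : (Subset n → ℕ) → Indicator n → ℕ
weigh u φ = ∑ (λ A → 𝟙 (φ A) * u A)

-- Here `a`, `b` are the memberships of the two sets of a step and `x`, `y` their weights.
-- Compression turns `(a , b)` into `(a ∧ b , a ∨ b)`, so it can only replace the heavier set by the
-- lighter one.
∧-∨-exchange : ∀ a b x y → y ≤ x → 𝟙 (a ∧ b) * x + 𝟙 (a ∨ b) * y ≤ 𝟙 a * x + 𝟙 b * y
∧-∨-exchange false b     x y y≤x = ≤-refl
∧-∨-exchange true  true  x y y≤x = ≤-refl
∧-∨-exchange true  false x y y≤x =
  ≤-trans (+-monoˡ-≤ 0 y≤x) (+-monoˡ-≤ 0 (≤-reflexive (sym (+-identityʳ x))))

∧-∨-exchange-strict : ∀ a b x y → y < x →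
  𝟙 a * x + 𝟙 b * y ≤ 𝟙 (a ∧ b) * x + 𝟙 (a ∨ b) * y → T a → T b
∧-∨-exchange-strict true true  x y y<x _ _ = tt
∧-∨-exchange-strict true false x y y<x le _ =
  contradiction (subst₂ _≤_ (trans (+-identityʳ _) (+-identityʳ x)) (+-identityʳ y) le) (<⇒≱ y<x)

∧-∨-count : ∀ a b → 𝟙 (a ∧ b) + 𝟙 (a ∨ b) ≡ 𝟙 a + 𝟙 b
∧-∨-count false b     = refl
∧-∨-count true  true  = refl
∧-∨-count true  false = refl

pair-middle : ∀ a b c d → (a + b) + (c + d) ≡ (b + c) + (a + d)
pair-middle a b c d = trans (cong (_+ (c + d)) (+-comm a b)) (interchange b a c d)

-- Compression at `zero` affects only sets with exactly one of the first two elements. Pairing these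
-- by their common tail reduces its analysis to one pair at a time.
∑-split₂ : (f : Subset (suc (suc n)) → ℕ) →
  ∑ f ≡ ∑ (λ A → f (false ∷ true ∷ A) + f (true ∷ false ∷ A))
      + (∑ (λ A → f (false ∷ false ∷ A)) + ∑ (λ A → f (true ∷ true ∷ A)))
∑-split₂ f = trans (pair-middle (∑ (λ A → f (false ∷ false ∷ A))) _ _ _)
  (cong (_+ (∑ (λ A → f (false ∷ false ∷ A)) + ∑ (λ A → f (true ∷ true ∷ A))))
    (sym (∑-+ (λ A → f (false ∷ true ∷ A)) (λ A → f (true ∷ false ∷ A)))))

∑-cong : {f g : Subset n → ℕ} → (∀ A → f A ≡ g A) → ∑ f ≡ ∑ g
∑-cong f≡g = ≤-antisym (∑-mono (≤-reflexive ∘ f≡g)) (∑-mono (≤-reflexive ∘ sym ∘ f≡g))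

card-compress : ∀ (i : Fin n) φ → card (compress i φ) ≡ card φ
card-compress {suc zero}    zero    φ = refl
card-compress {suc (suc n)} zero    φ = trans (∑-split₂ (𝟙 ∘ compress zero φ)) (trans
  (cong (_+ (card (λ A → φ (false ∷ false ∷ A)) + card (λ A → φ (true ∷ true ∷ A))))
    (∑-cong (λ A → ∧-∨-count (φ (false ∷ true ∷ A)) (φ (true ∷ false ∷ A)))))
  (sym (∑-split₂ (𝟙 ∘ φ))))
card-compress {suc (suc n)} (suc i) φ =
  cong₂ _+_ (card-compress i (φ ∘ (false ∷_))) (card-compress i (φ ∘ (true ∷_)))

Decreasing : (Subset n → ℕ) → Set
Decreasing u = ∀ {A B} → A ⟶ B → u B < u A

StableAt : Fin n → Indicator n → Set
StableAt i φ = ∀ {A B} → Step i A B → A ∈ᵢ φ → B ∈ᵢ φ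

weigh-compress-≤ : ∀ (i : Fin n) φ {u} → Decreasing u → weigh u (compress i φ) ≤ weigh u φ
weigh-compress-≤ {suc zero}    zero    φ u↓ = ≤-refl
weigh-compress-≤ {suc (suc n)} zero    φ {u} u↓ = subst₂ _≤_
  (sym (∑-split₂ (λ A → 𝟙 (compress zero φ A) * u A))) (sym (∑-split₂ (λ A → 𝟙 (φ A) * u A)))
  (+-monoˡ-≤ _ (∑-mono λ A →
    ∧-∨-exchange (φ (false ∷ true ∷ A)) (φ (true ∷ false ∷ A)) _ _ (<⇒≤ (u↓ (zero , here)))))
weigh-compress-≤ {suc (suc n)} (suc i) φ u↓ = +-mono-≤
  (weigh-compress-≤ i (φ ∘ (false ∷_)) (u↓ ∘ there⟶))
  (weigh-compress-≤ i (φ ∘ (true ∷_)) (u↓ ∘ there⟶))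

-- No pair gains weight, so an unchanged total means that no pair loses weight either. As a step
-- lowers `u` strictly, no set was actually replaced.
weigh-compress-stable : ∀ (i : Fin n) φ {u} → Decreasing u →
  weigh u φ ≤ weigh u (compress i φ) → StableAt i φ
weigh-compress-stable {suc (suc n)} zero φ {u} u↓ le (here {A = A}) =
  ∧-∨-exchange-strict (φ (false ∷ true ∷ A)) (φ (true ∷ false ∷ A)) _ _ (u↓ (zero , here))
    (∑-squeeze
      (λ B → ∧-∨-exchange (φ (false ∷ true ∷ B)) (φ (true ∷ false ∷ B)) _ _ (<⇒≤ (u↓ (zero , here))))
      (+-cancelʳ-≤ _ _ _ (subst₂ _≤_
        (∑-split₂ (λ A → 𝟙 (φ A) * u A)) (∑-split₂ (λ A → 𝟙 (compress zero φ A) * u A)) le))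
      A)
weigh-compress-stable {suc (suc n)} (suc i) φ u↓ le (there {b = b} s)
  with +-squeeze (weigh-compress-≤ i (φ ∘ (false ∷_)) (u↓ ∘ there⟶))
                 (weigh-compress-≤ i (φ ∘ (true ∷_)) (u↓ ∘ there⟶)) le
weigh-compress-stable {suc (suc n)} (suc i) φ u↓ le (there {b = false} s) | le₀ , _ =
  weigh-compress-stable i (φ ∘ (false ∷_)) (u↓ ∘ there⟶) le₀ s
weigh-compress-stable {suc (suc n)} (suc i) φ u↓ le (there {b = true} s) | _ , le₁ =
  weigh-compress-stable i (φ ∘ (true ∷_)) (u↓ ∘ there⟶) le₁ s

compress-origin : ∀ (i : Fin n) φ {A} → A ∈ᵢ compress i φ →
  A ∈ᵢ φ ⊎ ∃ λ B → Step i B A × B ∈ᵢ φ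
compress-origin {suc zero}    zero φ {_ ∷ []}            A∈ = inj₁ A∈
compress-origin {suc (suc n)} zero φ {false ∷ false ∷ _} A∈ = inj₁ A∈
compress-origin {suc (suc n)} zero φ {false ∷ true  ∷ _} A∈ = inj₁ (proj₁ (T-∧⁻ A∈))
compress-origin {suc (suc n)} zero φ {true  ∷ true  ∷ _} A∈ = inj₁ A∈
compress-origin {suc (suc n)} zero φ {true  ∷ false ∷ _} A∈ with T-∨⁻ A∈
... | inj₁ B∈ = inj₂ (_ , here , B∈)
... | inj₂ A∈ = inj₁ A∈
compress-origin {suc (suc n)} (suc i) φ {b ∷ _} A∈ with compress-origin i (φ ∘ (b ∷_)) A∈
... | inj₁ A∈           = inj₁ A∈
... | inj₂ (B , s , B∈) = inj₂ (b ∷ B , there s , B∈)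

∣∣-step : {A B : Subset n} → A ⟶ B → ∣ B ∣ ≡ ∣ A ∣
∣∣-step (_ , here)                = refl
∣∣-step (_ , there {b = false} s) = ∣∣-step (_ , s)
∣∣-step (_ , there {b = true} s)  = cong suc (∣∣-step (_ , s))

-- A step moves an element to the left, so it can enter [m] but never leave it; it enters exactly
-- when the boundary lies between the two positions.
∣∩initial∣-step : ∀ m {A B : Subset n} → A ⟶ B → ∣ A ∩ initial m ∣ ≤ ∣ B ∩ initial m ∣
∣∩initial∣-step zero          (_ , here)                = ≤-refl
∣∩initial∣-step (suc zero)    (_ , here)                = n≤1+n _
∣∩initial∣-step (suc (suc m)) (_ , here)                = ≤-refl
∣∩initial∣-step zero          (_ , there {b = false} s) = ∣∩initial∣-step zero (_ , s)
∣∩initial∣-step zero          (_ , there {b = true} s)  = ∣∩initial∣-step zero (_ , s)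
∣∩initial∣-step (suc m)       (_ , there {b = false} s) = ∣∩initial∣-step m (_ , s)
∣∩initial∣-step (suc m)       (_ , there {b = true} s)  = s≤s (∣∩initial∣-step m (_ , s))

-- The sum of the members' positions, counted from 0: prepending an entry shifts every member of the
-- tail by one, which adds `∣ A ∣`.
positionSum : Subset n → ℕ
positionSum []      = 0
positionSum (b ∷ A) = positionSum A + ∣ A ∣

positionSum-decreasing : Decreasing (positionSum {n})
positionSum-decreasing (_ , here {A = A}) = +-monoʳ-< (positionSum A + ∣ A ∣) (n<1+n ∣ A ∣)
positionSum-decreasing (_ , there s) =
  +-mono-<-≤ (positionSum-decreasing (_ , s)) (≤-reflexive (∣∣-step (_ , s)))

-- Intersections under compression

UpwardClosed : (ℕ → Set) → Set
UpwardClosed P = ∀ k → P k → P (suc k)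

-- One predicate `P` on intersection sizes serves both `1 ≤_` and `t ≤_`, and lets an induction past
-- a common first element continue with `P ∘ suc`.
Meeting : (ℕ → Set) → Indicator n → Indicator n → Set
Meeting P φ ψ = ∀ A B → A ∈ᵢ φ → B ∈ᵢ ψ → P ∣ A ∩ B ∣

-- Each pair from the compressed families is traced back to a pair of old members that meet in
-- equally many elements or in one fewer.
compress-meeting : ∀ (i : Fin n) {P} → UpwardClosed P → ∀ {φ ψ} →
  Meeting P φ ψ → Meeting P (compress i φ) (compress i ψ)
compress-meeting {suc zero} zero _ meet A B = meet A B
compress-meeting {suc (suc n)} zero P↑ meet (false ∷ false ∷ A) (false ∷ false ∷ B) a b =
  meet _ _ a b
compress-meeting {suc (suc n)} zero P↑ meet (false ∷ false ∷ A) (false ∷ true  ∷ B) a b =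
  meet _ _ a (proj₁ (T-∧⁻ b))
compress-meeting {suc (suc n)} zero P↑ meet (false ∷ false ∷ A) (true  ∷ false ∷ B) a b with T-∨⁻ b
... | inj₁ b = meet _ _ a b
... | inj₂ b = meet _ _ a b
compress-meeting {suc (suc n)} zero P↑ meet (false ∷ false ∷ A) (true  ∷ true  ∷ B) a b =
  meet _ _ a b
compress-meeting {suc (suc n)} zero P↑ meet (true  ∷ true  ∷ A) (false ∷ false ∷ B) a b =
  meet _ _ a b
compress-meeting {suc (suc n)} zero P↑ meet (true  ∷ true  ∷ A) (false ∷ true  ∷ B) a b =
  meet _ _ a (proj₁ (T-∧⁻ b))
compress-meeting {suc (suc n)} zero P↑ meet (true  ∷ true  ∷ A) (true  ∷ false ∷ B) a b with T-∨⁻ b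
... | inj₁ b = meet _ _ a b
... | inj₂ b = meet _ _ a b
compress-meeting {suc (suc n)} zero P↑ meet (true  ∷ true  ∷ A) (true  ∷ true  ∷ B) a b =
  meet _ _ a b
compress-meeting {suc (suc n)} zero P↑ meet (false ∷ true  ∷ A) (false ∷ false ∷ B) a b =
  meet _ _ (proj₁ (T-∧⁻ a)) b
compress-meeting {suc (suc n)} zero P↑ meet (false ∷ true  ∷ A) (false ∷ true  ∷ B) a b =
  meet _ _ (proj₁ (T-∧⁻ a)) (proj₁ (T-∧⁻ b))
compress-meeting {suc (suc n)} zero P↑ meet (false ∷ true  ∷ A) (true  ∷ false ∷ B) a b with T-∨⁻ b
-- The first set survives compression only because its swapped copy is a member too. That copy is
-- disjoint from the old second set on the two positions, just like the given pair.
... | inj₁ b = meet (true ∷ false ∷ A) (false ∷ true ∷ B) (proj₂ (T-∧⁻ a)) b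
... | inj₂ b = meet _ _ (proj₁ (T-∧⁻ a)) b
compress-meeting {suc (suc n)} zero P↑ meet (false ∷ true  ∷ A) (true  ∷ true  ∷ B) a b =
  meet _ _ (proj₁ (T-∧⁻ a)) b
compress-meeting {suc (suc n)} zero P↑ meet (true  ∷ false ∷ A) (false ∷ false ∷ B) a b with T-∨⁻ a
... | inj₁ a = meet _ _ a b
... | inj₂ a = meet _ _ a b
compress-meeting {suc (suc n)} zero P↑ meet (true  ∷ false ∷ A) (true  ∷ true  ∷ B) a b with T-∨⁻ a
... | inj₁ a = meet _ _ a b
... | inj₂ a = meet _ _ a b
compress-meeting {suc (suc n)} zero P↑ meet (true  ∷ false ∷ A) (false ∷ true  ∷ B) a b with T-∨⁻ a
... | inj₁ a = meet (false ∷ true ∷ A) (true ∷ false ∷ B) a (proj₂ (T-∧⁻ b))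
... | inj₂ a = meet _ _ a (proj₁ (T-∧⁻ b))
compress-meeting {suc (suc n)} zero P↑ meet (true  ∷ false ∷ A) (true  ∷ false ∷ B) a b with T-∨⁻ a | T-∨⁻ b
... | inj₁ a | inj₁ b = meet (false ∷ true ∷ A) (false ∷ true ∷ B) a b
-- The old sets occupy different positions of the two, the new ones share a position: the
-- intersection grows by one.
... | inj₁ a | inj₂ b = P↑ _ (meet (false ∷ true ∷ A) (true ∷ false ∷ B) a b)
... | inj₂ a | inj₁ b = P↑ _ (meet (true ∷ false ∷ A) (false ∷ true ∷ B) a b)
... | inj₂ a | inj₂ b = meet _ _ a b
compress-meeting {suc (suc n)} (suc i) {P} P↑ meet (false ∷ A) (b ∷ B) =
  compress-meeting i {P} P↑ (λ A B → meet (false ∷ A) (b ∷ B)) A B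
compress-meeting {suc (suc n)} (suc i) {P} P↑ meet (true ∷ A) (false ∷ B) =
  compress-meeting i {P} P↑ (λ A B → meet (true ∷ A) (false ∷ B)) A B
compress-meeting {suc (suc n)} (suc i) {P} P↑ meet (true ∷ A) (true ∷ B) =
  compress-meeting i {P ∘ suc} (P↑ ∘ suc) (λ A B → meet (true ∷ A) (true ∷ B)) A B

-- Lattice paths

-- Capped d A B: the initial segments satisfy ∣ A ∩ [j] ∣ + ∣ B ∩ [j] ∣ ≤ j + d for all j.
data Capped : ℕ → Subset n → Subset n → Set where
  []    : Capped d [] []
  both  : {A B : Subset n} → Capped d A B → Capped (suc d) (true ∷ A) (true ∷ B)
  left  : {A B : Subset n} → Capped d A B → Capped d (true ∷ A) (false ∷ B)
  right : {A B : Subset n} → Capped d A B → Capped d (false ∷ A) (true ∷ B)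
  none  : {A B : Subset n} → Capped (suc d) A B → Capped d (false ∷ A) (false ∷ B)

Capped-suc : {A B : Subset n} → Capped d A B → Capped (suc d) A B
Capped-suc []        = []
Capped-suc (both c)  = both (Capped-suc c)
Capped-suc (left c)  = left (Capped-suc c)
Capped-suc (right c) = right (Capped-suc c)
Capped-suc (none c)  = none (Capped-suc c)

there⟶* : ∀ b {A B : Subset n} → A ⟶* B → b ∷ A ⟶* b ∷ B
there⟶* b = gmap (b ∷_) there⟶

-- The net effect is that the first common element leaves `B` for the empty position in front.
-- Elements of `B` met on the way each move one place, so that together they refill the places they
-- vacate.
pull-common : (A B : Subset n) → 1 ≤ ∣ A ∩ B ∣ →
  ∃ λ B′ → (false ∷ B ⟶* true ∷ B′) × suc ∣ A ∩ B′ ∣ ≡ ∣ A ∩ B ∣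
pull-common [] [] ()
pull-common (true ∷ A) (true ∷ B) _ = false ∷ B , (zero , here) ◅ ε , refl
pull-common (true ∷ A) (false ∷ B) 1≤ with pull-common A B 1≤
... | B′ , steps , eq = false ∷ B′ , there⟶* false steps ◅◅ (zero , here) ◅ ε , eq
pull-common (false ∷ A) (false ∷ B) 1≤ with pull-common A B 1≤
... | B′ , steps , eq = false ∷ B′ , there⟶* false steps ◅◅ (zero , here) ◅ ε , eq
pull-common (false ∷ A) (true ∷ B) 1≤ with pull-common A B 1≤
... | B′ , steps , eq = true ∷ B′ , (zero , here) ◅ there⟶* true steps , eq

-- Work from the back. A common element is paid for by the drop in `d` at `both`. At a position
-- empty in both sets the tail only guarantees `suc d`; if that bound is attained, a common element
-- is moved into the empty position, which `A` does not use.
Capped⇒separable : {A B : Subset n} → Capped d A B → ∃ λ B′ → (B ⟶* B′) × ∣ A ∩ B′ ∣ ≤ d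
Capped⇒separable [] = [] , ε , z≤n
Capped⇒separable (both c) with Capped⇒separable c
... | B′ , steps , le = true ∷ B′ , there⟶* true steps , s≤s le
Capped⇒separable (left c) with Capped⇒separable c
... | B′ , steps , le = false ∷ B′ , there⟶* false steps , le
Capped⇒separable (right c) with Capped⇒separable c
... | B′ , steps , le = true ∷ B′ , there⟶* true steps , le
Capped⇒separable {d = d} (none {A = A} c) with Capped⇒separable c
... | B′ , steps , le with ∣ A ∩ B′ ∣ ≤? d
...   | yes le′ = false ∷ B′ , there⟶* false steps , le′
...   | no ≰d with pull-common A B′ (≤-trans (s≤s z≤n) (≰⇒> ≰d))
...     | B″ , steps′ , eq =
  true ∷ B″ , there⟶* false steps ◅◅ steps′ , ≤-pred (≤-trans (≤-reflexive eq) le)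

-- Reading A as a path with p up-steps and q down-steps to start with (members are
-- up-steps), Reach p q A says that the path gets to a height ≥ 0.
data Reach : ℕ → ℕ → Subset n → Set where
  now  : {A : Subset n} → q ≤ p → Reach p q A
  up   : {A : Subset n} → Reach (suc p) q A → Reach p q (true ∷ A)
  down : {A : Subset n} → Reach p (suc q) A → Reach p q (false ∷ A)

reach? : ∀ p q (A : Subset n) → Dec (Reach p q A)
reach? p q A with q ≤? p
reach? p q A           | yes q≤p = yes (now q≤p)
reach? p q []          | no q≰p  = no λ { (now q≤p) → q≰p q≤p }
reach? p q (true ∷ A)  | no q≰p with reach? (suc p) q A
... | yes r = yes (up r)
... | no ¬r = no λ { (now q≤p) → q≰p q≤p ; (up r) → ¬r r }
reach? p q (false ∷ A) | no q≰p with reach? p (suc q) A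
... | yes r = yes (down r)
... | no ¬r = no λ { (now q≤p) → q≰p q≤p ; (down r) → ¬r r }

-- The path starts at height -(d + 1). Staying below 0 after j steps means that twice `∣ A ∩ [j] ∣`
-- is at most j + d.
¬Reach⇒Capped : ∀ d p (A : Subset n) → ¬ Reach p (suc (d + p)) A → Capped d A A
¬Reach⇒Capped d       p []          ¬r = []
¬Reach⇒Capped zero    p (true ∷ A)  ¬r = contradiction (up (now ≤-refl)) ¬r
¬Reach⇒Capped (suc d) p (true ∷ A)  ¬r =
  both (¬Reach⇒Capped d (suc p) A (¬r ∘ up ∘ subst (λ x → Reach (suc p) (suc x) A) (+-suc d p)))
¬Reach⇒Capped d       p (false ∷ A) ¬r = none (¬Reach⇒Capped (suc d) p A (¬r ∘ down))

-- Reflect p q A B: B is A with the part of its path up to the last visit to height 0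
-- reflected; after that visit the path stays below 0, which is the argument of last.
data Reflect : ℕ → ℕ → Subset n → Subset n → Set where
  end  : Reflect p p [] []
  last : {A : Subset n} → ¬ Reach p (suc p) A → Reflect p p (false ∷ A) (false ∷ A)
  up   : {A B : Subset n} → Reflect (suc p) q A B → Reflect p q (true ∷ A) (false ∷ B)
  down : {A B : Subset n} → Reflect p (suc q) A B → Reflect p q (false ∷ A) (true ∷ B)

-- The inequality says that the path ends at height at most 0. Having reached a height of at least 0
-- by unit steps, it has a last visit to 0, found by testing after each step whether such a height
-- is still to come.
reflect : {A : Subset n} → Reach p q A → p + ∣ A ∣ + ∣ A ∣ ≤ q + n → ∃ (Reflect p q A)
reflect {p = p} {q} {[]} (now q≤p) le
  rewrite +-identityʳ p | +-identityʳ p | +-identityʳ q with ≤-antisym le q≤p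
... | refl = [] , end
reflect {suc n} {p = p} {q} {true ∷ A} r le with reach? (suc p) q A
... | yes r′ with reflect r′ (≤-pred (subst₂ _≤_
       (trans (+-suc (p + suc ∣ A ∣) ∣ A ∣) (cong (λ x → suc (x + ∣ A ∣)) (+-suc p ∣ A ∣))) (+-suc q n) le))
...   | B , ρ = false ∷ B , up ρ
-- An up-step from height at least 0 stays there, so the last visit is never followed by an up-step.
reflect {A = true ∷ A} (now q≤p) le | no ¬r = contradiction (now (m≤n⇒m≤1+n q≤p)) ¬r
reflect {A = true ∷ A} (up r)    le | no ¬r = contradiction r ¬r
reflect {suc n} {p = p} {q} {false ∷ A} r le with reach? p (suc q) A
... | yes r′ with reflect r′ (subst (p + ∣ A ∣ + ∣ A ∣ ≤_) (+-suc q n) le)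
...   | B , ρ = true ∷ B , down ρ
reflect {A = false ∷ A} (down r)  le | no ¬r = contradiction r ¬r
-- The height is at least 0, but after the down-step it is negative, so it is 0 now.
reflect {A = false ∷ A} (now q≤p) le | no ¬r with ≤-antisym (≮⇒≥ (¬r ∘ now)) q≤p
... | refl = false ∷ A , last ¬r

Reflect⇒Reach : {A B : Subset n} → Reflect p q A B → Reach p q A
Reflect⇒Reach end      = now ≤-refl
Reflect⇒Reach (last _) = now ≤-refl
Reflect⇒Reach (up ρ)   = up (Reflect⇒Reach ρ)
Reflect⇒Reach (down ρ) = down (Reflect⇒Reach ρ)

Reflect-sym : {A B : Subset n} → Reflect p q A B → Reflect q p B A
Reflect-sym end       = end
Reflect-sym (last ¬r) = last ¬r
Reflect-sym (up ρ)    = down (Reflect-sym ρ)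
Reflect-sym (down ρ)  = up (Reflect-sym ρ)

-- The only ambiguity is whether to stop at a visit to 0 or to go on, and it is settled by whether
-- the path comes back. Since the relation is symmetric, this also gives injectivity.
Reflect-functional : {A B B′ : Subset n} → Reflect p q A B → Reflect p q A B′ → B ≡ B′
Reflect-functional end       end       = refl
Reflect-functional (last _)  (last _)  = refl
Reflect-functional (last ¬r) (down ρ)  = contradiction (Reflect⇒Reach ρ) ¬r
Reflect-functional (down ρ)  (last ¬r) = contradiction (Reflect⇒Reach ρ) ¬r
Reflect-functional (up ρ)    (up ρ′)   = cong (false ∷_) (Reflect-functional ρ ρ′)
Reflect-functional (down ρ)  (down ρ′) = cong (true ∷_) (Reflect-functional ρ ρ′)

Reflect-injective : {A A′ B : Subset n} → Reflect p q A B → Reflect p q A′ B → A ≡ A′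
Reflect-injective ρ ρ′ = Reflect-functional (Reflect-sym ρ) (Reflect-sym ρ′)

-- Up to the last visit the two sets are complementary, using each position exactly once. Afterwards
-- they agree, and the path stays below 0.
Reflect⇒Capped : {A B : Subset n} → Reflect p q A B → Capped 0 A B
Reflect⇒Capped end                      = []
Reflect⇒Capped (last {p = p} {A = A} ¬r) = none (Capped-suc (¬Reach⇒Capped 0 p A ¬r))
Reflect⇒Capped (up ρ)                   = left (Reflect⇒Capped ρ)
Reflect⇒Capped (down ρ)                 = right (Reflect⇒Capped ρ)

∣∣-reflect : {A B : Subset n} → Reflect p q A B → ∣ B ∣ + q ≡ ∣ A ∣ + p
∣∣-reflect end      = refl
∣∣-reflect (last _) = refl
∣∣-reflect (up ρ)   = trans (∣∣-reflect ρ) (+-suc _ _)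
∣∣-reflect (down ρ) = trans (sym (+-suc _ _)) (∣∣-reflect ρ)

∣∩initial∣-zero : (A : Subset n) → ∣ A ∩ initial 0 ∣ ≡ 0
∣∩initial∣-zero []          = refl
∣∩initial∣-zero (false ∷ A) = ∣∩initial∣-zero A
∣∩initial∣-zero (true ∷ A)  = ∣∩initial∣-zero A

-- The first case is that of a last visit within [m], the second that of a later one.
∣∩initial∣-reflect : ∀ m {A B : Subset n} → Reflect p q A B →
  ∣ B ∩ initial m ∣ + q ≡ ∣ A ∩ initial m ∣ + p ⊎ ∣ B ∩ initial m ∣ + ∣ A ∩ initial m ∣ ≡ m
∣∩initial∣-reflect zero {A} {B} ρ = inj₂ (cong₂ _+_ (∣∩initial∣-zero B) (∣∩initial∣-zero A))
∣∩initial∣-reflect (suc m) end      = inj₁ refl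
∣∩initial∣-reflect (suc m) (last _) = inj₁ refl
∣∩initial∣-reflect (suc m) (up ρ) with ∣∩initial∣-reflect m ρ
... | inj₁ eq = inj₁ (trans eq (+-suc _ _))
... | inj₂ eq = inj₂ (trans (+-suc _ _) (cong suc eq))
∣∩initial∣-reflect (suc m) (down ρ) with ∣∩initial∣-reflect m ρ
... | inj₁ eq = inj₁ (trans (sym (+-suc _ _)) eq)
... | inj₂ eq = inj₂ (cong suc eq)

-- The extremal inequality

Stable : Indicator n → Set
Stable φ = ∀ {A B} → A ⟶ B → A ∈ᵢ φ → B ∈ᵢ φ

Stable-⟶* : {φ : Indicator n} → Stable φ → ∀ {A B} → A ⟶* B → A ∈ᵢ φ → B ∈ᵢ φ
Stable-⟶* st ε        A∈ = A∈
Stable-⟶* st (s ◅ ss) A∈ = Stable-⟶* st ss (st s A∈)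

-- The moves that would separate a capped pair stay inside the stable family, contradicting the
-- lower bound on intersections.
¬Capped : {φ ψ : Indicator n} → Stable ψ → Meeting (suc d ≤_) φ ψ →
  ∀ {A B} → A ∈ᵢ φ → B ∈ᵢ ψ → ¬ Capped d A B
¬Capped st meet A∈ B∈ c with Capped⇒separable c
... | B′ , steps , le = <⇒≱ (meet _ B′ A∈ (Stable-⟶* st steps B∈)) le

intersecting⇒Reach : ∀ t {φ : Indicator n} → Stable φ → Meeting (t ≤_) φ φ →
  ∀ {A} → A ∈ᵢ φ → Reach 0 t A
intersecting⇒Reach zero    st meet A∈ = now z≤n
intersecting⇒Reach (suc d) st meet {A} A∈ with reach? 0 (suc d) A
... | yes r = r
... | no ¬r = contradiction
  (¬Reach⇒Capped d 0 A (¬r ∘ subst (λ x → Reach 0 (suc x) A) (+-identityʳ d)))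
  (¬Capped st meet A∈ A∈)

uniform : ℕ → ℕ → ℕ → Indicator n
uniform k r m A = ⌊ (∣ A ∣ ≟ k) ×-dec (r ≤? ∣ A ∩ initial m ∣) ⌋

record Admissible (t s k m : ℕ) (φ ψ : Indicator n) : Set where
  field
    φ-uniform    : ∀ {A} → A ∈ᵢ φ → A ∈ᵢ uniform (k + t) (t + s + 1) m
    ψ-uniform    : ∀ {B} → B ∈ᵢ ψ → B ∈ᵢ uniform k (suc s) m
    cross        : Meeting (1 ≤_) φ ψ
    intersecting : Meeting (t ≤_) φ φ

compress-uniform : ∀ (i : Fin n) {k r m φ} → (∀ {A} → A ∈ᵢ φ → A ∈ᵢ uniform k r m) →
  ∀ {A} → A ∈ᵢ compress i φ → A ∈ᵢ uniform k r m
compress-uniform i {m = m} {φ} unif A∈ with compress-origin i φ A∈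
... | inj₁ A∈           = unif A∈
... | inj₂ (B , s , B∈) with toWitness (unif B∈)
...   | ∣A∣≡ , large =
  fromWitness (trans (∣∣-step (i , s)) ∣A∣≡ , ≤-trans large (∣∩initial∣-step m (i , s)))

compress-admissible : ∀ (i : Fin n) {t s k m φ ψ} →
  Admissible t s k m φ ψ → Admissible t s k m (compress i φ) (compress i ψ)
compress-admissible i {t} {m = m} adm = record
  { φ-uniform    = compress-uniform i {m = m} φ-uniform
  ; ψ-uniform    = compress-uniform i {m = m} ψ-uniform
  ; cross        = compress-meeting i {1 ≤_} (λ _ → m≤n⇒m≤1+n) cross
  ; intersecting = compress-meeting i {t ≤_} (λ _ → m≤n⇒m≤1+n) intersecting
  }
  where open Admissible adm

T-not⁺ : ∀ {b} → ¬ T b → T (not b)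
T-not⁺ {false} _  = tt
T-not⁺ {true}  ¬b = ¬b tt

T-not⁻ : ∀ {b} → T (not b) → ¬ T b
T-not⁻ {false} _ ()

module _ {t s k n m : ℕ} (2k+t≤n : 2 * k + t ≤ n) (k+t+s<m : k + t + s < m) where

  stable-bound : {φ ψ : Indicator n} → Admissible t s k m φ ψ → Stable φ → Stable ψ →
    card φ + card ψ ≤ card {n} (uniform k (suc s) m)
  stable-bound {φ} {ψ} adm φ-stable ψ-stable = begin
    card φ + card ψ
      ≤⟨ +-monoˡ-≤ (card ψ) (card-injection φ χ (proj₁ ∘ mirror)
           (λ A∈ → reflect∈χ A∈ (proj₂ (mirror A∈))) mirror-injective) ⟩
    card χ + card ψ
      ≤⟨ card-disjoint χ ψ (uniform k (suc s) m)
           (T-not⁻ ∘ proj₂ ∘ T-∧⁻) (proj₁ ∘ T-∧⁻) ψ-uniform ⟩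
    card {n} (uniform k (suc s) m) ∎
    where
    open ≤-Reasoning
    open Admissible adm

    χ : Indicator n
    χ B = uniform k (suc s) m B ∧ not (ψ B)

    -- Started at height -t, the path of `A` ends at height at most 0; this is where n ≥ 2k + t
    -- enters.
    path-end : ∀ {A} → A ∈ᵢ φ → ∣ A ∣ + ∣ A ∣ ≤ t + n
    path-end {A} A∈ = begin
      ∣ A ∣ + ∣ A ∣       ≡⟨ cong₂ _+_ ∣A∣≡ ∣A∣≡ ⟩
      (k + t) + (k + t)   ≡⟨ interchange k t k t ⟩
      (k + k) + (t + t)   ≡⟨ sym (+-assoc (k + k) t t) ⟩
      (k + k + t) + t     ≡⟨ +-comm (k + k + t) t ⟩
      t + (k + k + t)     ≡⟨ cong (λ x → t + (k + x + t)) (sym (+-identityʳ k)) ⟩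
      t + (2 * k + t)     ≤⟨ +-monoʳ-≤ t 2k+t≤n ⟩
      t + n               ∎
      where ∣A∣≡ = proj₁ (toWitness (φ-uniform A∈))

    mirror : ∀ {A} → A ∈ᵢ φ → ∃ (Reflect 0 t A)
    mirror A∈ = reflect (intersecting⇒Reach t φ-stable intersecting A∈) (path-end A∈)

    reflect∈χ : ∀ {A B} → A ∈ᵢ φ → Reflect 0 t A B → B ∈ᵢ χ
    reflect∈χ {A} {B} A∈ ρ = T-∧⁺ (fromWitness (∣B∣≡k , s<∣B∩[m]∣)) (T-not⁺ B∉ψ)
      where
      ∣A∣≡ = proj₁ (toWitness (φ-uniform A∈))
      large = proj₂ (toWitness (φ-uniform A∈))

      ∣B∣≡k : ∣ B ∣ ≡ k
      ∣B∣≡k = +-cancelʳ-≡ t ∣ B ∣ k (trans (∣∣-reflect ρ) (trans (+-identityʳ ∣ A ∣) ∣A∣≡))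

      ∣A∩[m]∣≤ : ∣ A ∩ initial m ∣ ≤ k + t
      ∣A∩[m]∣≤ = ≤-trans (p⊆q⇒∣p∣≤∣q∣ (p∩q⊆p A (initial m))) (≤-reflexive ∣A∣≡)

      s<∣B∩[m]∣ : suc s ≤ ∣ B ∩ initial m ∣
      s<∣B∩[m]∣ with ∣∩initial∣-reflect m ρ
      ... | inj₁ eq = +-cancelʳ-≤ t _ _ (begin
        suc s + t                  ≡⟨ +-comm (suc s) t ⟩
        t + suc s                  ≡⟨ cong (λ x → t + x) (+-comm 1 s) ⟩
        t + (s + 1)                ≡⟨ sym (+-assoc t s 1) ⟩
        t + s + 1                  ≤⟨ large ⟩
        ∣ A ∩ initial m ∣          ≡⟨ sym (+-identityʳ _) ⟩
        ∣ A ∩ initial m ∣ + 0      ≡⟨ sym eq ⟩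
        ∣ B ∩ initial m ∣ + t      ∎)
      ... | inj₂ eq = +-cancelʳ-≤ (k + t) _ _ (begin
        suc s + (k + t)                       ≡⟨ cong suc (+-comm s (k + t)) ⟩
        suc (k + t + s)                       ≤⟨ k+t+s<m ⟩
        m                                     ≡⟨ sym eq ⟩
        ∣ B ∩ initial m ∣ + ∣ A ∩ initial m ∣ ≤⟨ +-monoʳ-≤ ∣ B ∩ initial m ∣ ∣A∩[m]∣≤ ⟩
        ∣ B ∩ initial m ∣ + (k + t)           ∎)

      B∉ψ : ¬ (B ∈ᵢ ψ)
      B∉ψ B∈ = ¬Capped ψ-stable cross A∈ B∈ (Reflect⇒Capped ρ)

    mirror-injective : ∀ {A A′} (A∈ : A ∈ᵢ φ) (A′∈ : A′ ∈ᵢ φ) →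
      proj₁ (mirror A∈) ≡ proj₁ (mirror A′∈) → A ≡ A′
    mirror-injective A∈ A′∈ eq =
      Reflect-injective (subst (Reflect 0 t _) eq (proj₂ (mirror A∈))) (proj₂ (mirror A′∈))

  potential : Indicator n → Indicator n → ℕ
  potential φ ψ = weigh positionSum φ + weigh positionSum ψ

  -- Compress as long as some compression lowers the potential. When none does, neither weight can
  -- drop on its own, since neither can rise to make up for it; hence both families are stable.
  admissible-bound : (φ ψ : Indicator n) → Admissible t s k m φ ψ →
    Acc _<_ (potential φ ψ) → card φ + card ψ ≤ card {n} (uniform k (suc s) m)
  admissible-bound φ ψ adm (acc rec)
    with Fin.any? (λ i → potential (compress i φ) (compress i ψ) <? potential φ ψ)
  ... | yes (i , lt) = subst (_≤ card {n} (uniform k (suc s) m))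
    (cong₂ _+_ (card-compress i φ) (card-compress i ψ))
    (admissible-bound (compress i φ) (compress i ψ) (compress-admissible i adm) (rec lt))
  ... | no ∄i = stable-bound adm
    (λ (i , s) → weigh-compress-stable i φ positionSum-decreasing (proj₁ (squeeze i)) s)
    (λ (i , s) → weigh-compress-stable i ψ positionSum-decreasing (proj₂ (squeeze i)) s)
    where
    squeeze : ∀ i → weigh positionSum φ ≤ weigh positionSum (compress i φ)
                  × weigh positionSum ψ ≤ weigh positionSum (compress i ψ)
    squeeze i = +-squeeze
      (weigh-compress-≤ i φ positionSum-decreasing)
      (weigh-compress-≤ i ψ positionSum-decreasing)
      (≮⇒≥ (λ lt → ∄i (i , lt)))

-- Counting

layer : ℕ → Indicator n
layer k A = ⌊ ∣ A ∣ ≟ k ⌋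

card-layer : ∀ n k → card {n} (layer k) ≡ n C k
card-layer zero    zero    = refl
card-layer zero    (suc k) = refl
card-layer (suc n) zero    = cong₂ _+_ (card-layer n zero) (∑-zero {n})
card-layer (suc n) (suc k) = trans
  (cong₂ _+_ (card-layer n (suc k)) (trans
    (≤-antisym (card-mono (layer (suc k) ∘ (true ∷_)) (layer {n} k)
      (λ A∈ → fromWitness (suc-injective (toWitness A∈))))
               (card-mono (layer {n} k) (layer (suc k) ∘ (true ∷_))
      (λ A∈ → fromWitness (cong suc (toWitness A∈)))))
    (card-layer n k)))
  (trans (+-comm (n C suc k) (n C k)) (nCk+nC[k+1]≡[n+1]C[k+1] n k))

trace : ℕ → ℕ → ℕ → Indicator n
trace k i m A = ⌊ (∣ A ∣ ≟ k) ×-dec (∣ A ∩ initial m ∣ ≟ i) ⌋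

-- Induction on `m` by Pascal's rule, splitting on the first element. A lower bound suffices because
-- these counts are subtracted in the end.
card-trace : ∀ m r i j → (m C i) * (r C j) ≤ card {m + r} (trace (i + j) i m)
card-trace zero r zero j = begin
  1 * (r C j)                ≡⟨ +-identityʳ (r C j) ⟩
  r C j                    ≡⟨ sym (card-layer r j) ⟩
  card {r} (layer j)       ≤⟨ card-mono (layer {r} j) (trace j 0 0)
                                (λ {A} A∈ → fromWitness (toWitness A∈ , ∣∩initial∣-zero A)) ⟩
  card {r} (trace j 0 0)   ∎
  where open ≤-Reasoning
card-trace zero    r (suc i) j = z≤n
-- For trace 0 only the sets avoiding the first element are counted.
card-trace (suc m) r zero    j = ≤-trans (card-trace m r zero j) (m≤m+n _ _)
card-trace (suc m) r (suc i) j = begin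
  (suc m C suc i) * (r C j)
    ≡⟨ cong (_* (r C j)) (sym (nCk+nC[k+1]≡[n+1]C[k+1] m i)) ⟩
  (m C i + m C suc i) * (r C j)
    ≡⟨ *-distribʳ-+ (r C j) (m C i) (m C suc i) ⟩
  (m C i) * (r C j) + (m C suc i) * (r C j)
    ≡⟨ +-comm ((m C i) * (r C j)) _ ⟩
  (m C suc i) * (r C j) + (m C i) * (r C j)
    ≤⟨ +-mono-≤ (card-trace m r (suc i) j) (≤-trans (card-trace m r i j)
         (card-mono (trace (i + j) i m) (trace (suc i + j) (suc i) (suc m) ∘ (true ∷_))
           (λ {A} → suc-trace {A}))) ⟩
  card {suc m + r} (trace (suc i + j) (suc i) (suc m)) ∎
  where
  open ≤-Reasoning
  suc-trace : {A : Subset (m + r)} → A ∈ᵢ trace (i + j) i m →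
    (true ∷ A) ∈ᵢ trace (suc i + j) (suc i) (suc m)
  suc-trace A∈ with toWitness A∈
  ... | ∣A∣≡ , ∣A∩[m]∣≡ = fromWitness (cong suc ∣A∣≡ , cong suc ∣A∩[m]∣≡)

binom*binom≤card-trace : ∀ n m {k i} → i ≤ k →
  binom (+ m) i * binom (+ n - + m) (k ∸ i) ≤ card {n} (trace k i m)
binom*binom≤card-trace n m {k} {i} i≤k with m ≤? n
... | yes m≤n with m≤n⇒∃[o]m+o≡n m≤n
...   | r , refl = begin
  (m C i) * binom (+ (m + r) - + m) (k ∸ i)  ≡⟨ cong (λ z → (m C i) * binom z (k ∸ i)) [m+r]-m≡r ⟩
  (m C i) * (r C (k ∸ i))                      ≤⟨ card-trace m r i (k ∸ i) ⟩
  card {m + r} (trace (i + (k ∸ i)) i m)   ≡⟨ cong (λ x → card {m + r} (trace x i m)) (m+[n∸m]≡n i≤k) ⟩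
  card {m + r} (trace k i m)               ∎
  where
  open ≤-Reasoning
  [m+r]-m≡r : + (m + r) - + m ≡ + r
  [m+r]-m≡r = trans (ℤ.m-n≡m⊖n (m + r) m) (trans (ℤ.⊖-≥ m≤n) (cong +_ (m+n∸m≡n m r)))
-- For m > n the upper argument n - m is negative, so the product is 0 by convention.
binom*binom≤card-trace n m {k} {i} i≤k | no m≰n = ≤-trans (≤-reflexive
  (trans (cong (λ z → (m C i) * z) vanishes) (*-zeroʳ (m C i)))) z≤n
  where
  binom-neg : ∀ d {b} → 0 < d → binom (ℤ.- (+ d)) b ≡ 0
  binom-neg (suc d) _ = refl

  vanishes : binom (+ n - + m) (k ∸ i) ≡ 0
  vanishes = trans
    (cong (λ z → binom z (k ∸ i)) (trans (ℤ.m-n≡m⊖n n m) (ℤ.⊖-≰ m≰n)))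
    (binom-neg (m ∸ n) (m<n⇒0<n∸m (≰⇒> m≰n)))

-- Used with `T i` counting the k-sets that meet [m] in at least `i` elements, and `f i` bounding
-- from below those that meet it in exactly `i`.
sum-telescope : ∀ (T f : ℕ → ℕ) r → (∀ {i} → i < r → T (suc i) + f i ≤ T i) →
  T r + sum (map f (upTo r)) ≤ T 0
sum-telescope T f zero    step = ≤-reflexive (+-identityʳ (T 0))
sum-telescope T f (suc r) step = begin
  T (suc r) + sum (map f (upTo (suc r)))
    ≡⟨ cong (λ L → T (suc r) + sum (map f L)) (sym (applyUpTo-∷ʳ (λ i → i) r)) ⟩
  T (suc r) + sum (map f (upTo r ∷ʳ r))
    ≡⟨ cong (λ L → T (suc r) + sum L) (map-++ f (upTo r) _) ⟩
  T (suc r) + sum (map f (upTo r) ∷ʳ f r)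
    ≡⟨ cong (λ x → T (suc r) + x) (trans (sum-++ (map f (upTo r)) _) (+-comm S (f r + 0))) ⟩
  T (suc r) + (f r + 0 + S)
    ≡⟨ cong (λ x → T (suc r) + (x + S)) (+-identityʳ (f r)) ⟩
  T (suc r) + (f r + S)
    ≡⟨ sym (+-assoc (T (suc r)) (f r) S) ⟩
  T (suc r) + f r + S
    ≤⟨ +-monoˡ-≤ S (step (n<1+n r)) ⟩
  T r + S
    ≤⟨ sum-telescope T f r (step ∘ m<n⇒m<1+n) ⟩
  T 0 ∎
  where
  open ≤-Reasoning
  S = sum (map f (upTo r))

card-uniform : ∀ n m k r → r ≤ k →
  card {n} (uniform k r m) + sum (map (λ i → binom (+ m) i * binom (+ n - + m) (k ∸ i)) (upTo r))
    ≤ n C k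
card-uniform n m k r r≤k = begin
  card {n} (uniform k r m) + sum (map f (upTo r))
    ≤⟨ sum-telescope (λ i → card {n} (uniform k i m)) f r step ⟩
  card {n} (uniform k 0 m)
    ≤⟨ card-mono {n} (uniform k 0 m) (layer k) (λ A∈ → fromWitness (proj₁ (toWitness A∈))) ⟩
  card {n} (layer k)
    ≡⟨ card-layer n k ⟩
  n C k ∎
  where
  open ≤-Reasoning
  f = λ i → binom (+ m) i * binom (+ n - + m) (k ∸ i)

  step : ∀ {i} → i < r → card {n} (uniform k (suc i) m) + f i ≤ card {n} (uniform k i m)
  step {i} i<r = begin
    card {n} (uniform k (suc i) m) + f i
      ≤⟨ +-monoʳ-≤ (card {n} (uniform k (suc i) m))
           -- From `i < r` and `r ≤ k` the truncated difference `k ∸ i` is the true one.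
           (binom*binom≤card-trace n m (≤-trans (<⇒≤ i<r) r≤k)) ⟩
    card {n} (uniform k (suc i) m) + card {n} (trace k i m)
      ≤⟨ card-disjoint {n} (uniform k (suc i) m) (trace k i m) (uniform k i m)
           (λ u x → <⇒≢ (proj₂ (toWitness u)) (sym (proj₂ (toWitness x))))
           (λ u → fromWitness (proj₁ (toWitness u) , <⇒≤ (proj₂ (toWitness u))))
           (λ x → fromWitness (proj₁ (toWitness x) , ≤-reflexive (sym (proj₂ (toWitness x))))) ⟩
    card {n} (uniform k i m) ∎

-- From listed families to indicator functions, and the theorem

members-indicator : List (Subset n) → Indicator n
members-indicator L A = ⌊ mem? _≟ˢ_ A L ⌋

length≤card : (L : List (Subset n)) → Unique L → length L ≤ card (members-indicator L)
length≤card []      _             = z≤n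
length≤card (X ∷ L) (X∉L ∷ uniq) = begin
  1 + length L
    ≤⟨ +-mono-≤ (≤-trans (𝟙-mono {true} (λ _ → fromWitness refl)) (term≤∑ (𝟙 ∘ singleton) X))
                (length≤card L uniq) ⟩
  card singleton + card (members-indicator L)
    ≤⟨ card-disjoint singleton (members-indicator L) (members-indicator (X ∷ L))
         (λ A≡X A∈L → All.lookup X∉L (toWitness A∈L) (sym (toWitness A≡X)))
         (λ A≡X → fromWitness (here (toWitness A≡X)))
         (λ A∈L → fromWitness (there (toWitness A∈L))) ⟩
  card (members-indicator (X ∷ L)) ∎
  where
  open ≤-Reasoning
  singleton = λ A → ⌊ A ≟ˢ X ⌋

theorem3p3 : (t s k n m : ℕ) →
    s + 1 ≤ k →
    2 * k + t ≤ n →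
    k + t + s < m →
    (𝓕 𝓖 : Family n) →
    (∀ A → A ∈ 𝓕 → (∣ A ∣ ≡ k + t) × (t + s + 1 ≤ ∣ A ∩ initial m ∣)) →
    (∀ B → B ∈ 𝓖 → (∣ B ∣ ≡ k) × (s + 1 ≤ ∣ B ∩ initial m ∣)) →
    CrossIntersecting 𝓕 𝓖 →
    Intersecting t 𝓕 →
    + (size 𝓕 + size 𝓖) ≤ᶻ
    + binom (+ n) k
    - + sum (map (λ i → binom (+ m) i * binom (+ n - + m) (k ∸ i)) (upTo (suc s)))
theorem3p3 t s k n m s+1≤k 2k+t≤n k+t+s<m 𝓕 𝓖 𝓕-uniform 𝓖-uniform cross intersecting =
  subst (+ (size 𝓕 + size 𝓖) ≤ᶻ_)
    -- `bound` implies that `S` is at most `n C k`, so the integer difference agrees with the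
    -- truncated one.
    (sym (trans (ℤ.m-n≡m⊖n (n C k) S) (ℤ.⊖-≥ (m+n≤o⇒n≤o (size 𝓕 + size 𝓖) bound))))
    (+≤+ (m+n≤o⇒m≤o∸n (size 𝓕 + size 𝓖) bound))
  where
  open ≤-Reasoning

  S = sum (map (λ i → binom (+ m) i * binom (+ n - + m) (k ∸ i)) (upTo (suc s)))
  φ = members-indicator (members 𝓕)
  ψ = members-indicator (members 𝓖)

  s<k : suc s ≤ k
  s<k = subst (_≤ k) (+-comm s 1) s+1≤k

  ψ-uniform : ∀ {B} → B ∈ᵢ ψ → B ∈ᵢ uniform k (suc s) m
  ψ-uniform {B} B∈ with 𝓖-uniform B (toWitness B∈)
  ... | ∣B∣≡ , large = fromWitness (∣B∣≡ , subst (_≤ ∣ B ∩ initial m ∣) (+-comm s 1) large)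

  admissible : Admissible t s k m φ ψ
  admissible = record
    { φ-uniform    = λ A∈ → fromWitness (𝓕-uniform _ (toWitness A∈))
    ; ψ-uniform    = ψ-uniform
    ; cross        = λ A B A∈ B∈ → cross A B (toWitness A∈) (toWitness B∈)
    ; intersecting = λ A B A∈ B∈ → intersecting A B (toWitness A∈) (toWitness B∈)
    }

  bound : size 𝓕 + size 𝓖 + S ≤ n C k
  bound = begin
    size 𝓕 + size 𝓖 + S
      ≤⟨ +-monoˡ-≤ S (+-mono-≤ (length≤card (members 𝓕) (distinct 𝓕))
                            (length≤card (members 𝓖) (distinct 𝓖))) ⟩
    card φ + card ψ + S
      ≤⟨ +-monoˡ-≤ S (admissible-bound 2k+t≤n k+t+s<m φ ψ admissible (<-wellFounded _)) ⟩
    card {n} (uniform k (suc s) m) + S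
      ≤⟨ card-uniform n m k (suc s) s<k ⟩
    n C k ∎
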